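{- For any fixed integers $\omega>2$ and $d\ge2$ independent of $n$, StripIndependentSet is a 2-approximation algorithm for the Maximum Independent Set problem in $d$-dimensional Line of Sight networks with range parameter $\omega$: on any such network embedded in $\mathbb{Z}^d_n$ it runs in time polynomial in $n$ and returns an independent set whose total weight is at least half of the maximum total weight of an independent set.
   Context: $\mathbb{Z}^d_n=\{1,\dots,n\}^d$. Two distinct points share a line of sight if their coordinates differ in exactly one place. A vertex-weighted graph $G=(V,E,w)$ (positive weights) is a $d$-dimensional Line of Sight (LoS) network with range parameter $\omega$ if there is an embedding (injective map) $f_G:V\to\mathbb{Z}^d_n$ such that $\{u,v\}\in E$ if and only if $f_G(u)$ and $f_G(v)$ share a line of sight and their Manhattan distance is less than $\omega$. The network is given together with its embedding. The Maximum Independent Set (MIS) problem asks for an independent set maximizing the sum of the weights of its elements. StripIndependentSet: let $k=\omega-1$. For each index vector $(i_1,\dots,i_{d-1})$ with $i_h\in\{1,\dots,\lceil n/k\rceil\}$, the strip with that index is the subgraph of $G$ induced by the vertices embedded at points of $\mathbb{Z}^d_n$ of the form $(k(i_1-1)+j_1,\dots,k(i_{d-1}-1)+j_{d-1},i_d)$ with $j_h\in\{1,\dots,k\}$ for $h\in\{1,\dots,d-1\}$ and $i_d\in\{1,\dots,n\}$. A strip is odd (resp. even) if $\sum_{h=1}^{d-1}i_h$ is odd (resp. even). An optimal (maximum total weight) independent set is computed in each strip by an exact dynamic programming algorithm whose running time on such strips is polynomial in $n$ for fixed $k$, $d$ and $\omega$. The algorithm returns the set of larger total weight among: the union of the independent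 sets found in all odd strips, and the union of the independent sets found in all even strips. -}

module Defs where

open import Algebra.Bundles using (AbelianGroup)
import Algebra.Definitions.RawMonoid as RawMonoidDefinitions
open import Data.Bool.Base using (Bool; true; false; _∧_; _∨_; if_then_else_)
open import Data.Fin.Base using (Fin; zero; suc; toℕ; inject≤)
open import Data.Fin.Properties using (any?; all?; suc-injective)
open import Data.Fin.Subset using (Subset; inside; outside; _∈_; ∣_∣)
open import Data.List.Base using (List; foldr)
open import Data.Nat.Base using (ℕ; zero; suc; _+_; _*_; _∸_; _≤_; _<_; _≡ᵇ_; ∣_-_∣; NonZero; parity; >-nonZero)
open import Data.Nat.DivMod using (_/_)
open import Data.Nat.Properties using (m∸n≤m; <-trans; m<n⇒0<n∸m; n<1+n) renaming (_≟_ to _≟ℕ_)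
open import Data.Parity.Base using (Parity; 0ℙ; 1ℙ)
open import Data.Parity.Properties using () renaming (_≟_ to _≟ℙ_)
open import Data.Product.Base using (_×_; ∃-syntax)
open import Data.Product using (∃!)
open import Data.Unit.Base using (⊤; tt)
open import Data.Vec.Base using (Vec; []; _∷_; lookup; tabulate; zipWith; sum)
open import Function.Base using (_∘_)
open import Function.Bundles using (_⇔_)
open import Function.Definitions using (Injective)
open import Level using (Level; _⊔_) renaming (suc to lsuc)
open import Relation.Binary.Core using (Rel)
open import Relation.Binary.Definitions using (Symmetric; Irreflexive)
open import Relation.Binary.PropositionalEquality.Core using (_≡_; _≢_; refl; cong)
open import Relation.Binary.Structures using (IsDecTotalOrder)
open import Relation.Nullary.Decidable.Core using (Dec; does)
open import Relation.Nullary.Negation.Core using (¬_)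

private
  variable
    a b : Level
    A : Set a
    B : Set b
    m n : ℕ

------------------------------------------------------------------------
-- Running time.  A computation is a value together with the number of
-- elementary steps spent on it.  The cost model is the unit-cost RAM: a
-- step is one array access, one write, or one arithmetic, Boolean or
-- comparison operation on numbers or on weights.

record Timed (A : Set a) : Set a where
  constructor mkTimed
  field
    value : A
    time  : ℕ

open Timed public

step : A → Timed A
step x = mkTimed x 1

spend : ℕ → Timed ⊤
spend t = mkTimed tt t

infixl 1 _>>=_ _>>_

_>>=_ : Timed A → (A → Timed B) → Timed B
x >>= f = mkTimed (value (f (value x))) (time x + time (f (value x)))

_>>_ : Timed A → Timed B → Timed B
x >> y = x >>= λ _ → y

tabulateᵗ : (Fin n → Timed A) → Timed (Vec A n)
tabulateᵗ {n = zero}  f = step []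
tabulateᵗ {n = suc n} f = do
  x  ← f zero
  xs ← tabulateᵗ (f ∘ suc)
  step (x ∷ xs)

foldrᵗ : (A → B → Timed B) → Timed B → (Fin n → Timed A) → Timed B
foldrᵗ {n = zero}  _∙_ e f = e
foldrᵗ {n = suc n} _∙_ e f = do
  x ← f zero
  y ← foldrᵗ _∙_ e (f ∘ suc)
  x ∙ y

anyᵗ : (Fin n → Timed Bool) → Timed Bool
anyᵗ = foldrᵗ (λ x y → step (x ∨ y)) (step false)

allᵗ : (Fin n → Timed Bool) → Timed Bool
allᵗ = foldrᵗ (λ x y → step (x ∧ y)) (step true)

∅ᵗ : Timed (Subset m)
∅ᵗ = tabulateᵗ (λ _ → step outside)

_∪ᵗ_ : Subset m → Subset m → Timed (Subset m)
S ∪ᵗ T = tabulateᵗ λ v → do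
  x ← step (lookup S v)
  y ← step (lookup T v)
  step (x ∨ y)

-- The union of the sets F i over all vectors i ∈ {1,…,q}ᵉ.

⋃ᵗ : ∀ q e → (Vec (Fin q) e → Timed (Subset m)) → Timed (Subset m)
⋃ᵗ q zero    F = F []
⋃ᵗ q (suc e) F = foldrᵗ _∪ᵗ_ ∅ᵗ (λ x → ⋃ᵗ q e (λ xs → F (x ∷ xs)))

-- A polynomial is its list of coefficients, constant term first.

eval : List ℕ → ℕ → ℕ
eval p x = foldr (λ c r → c + x * r) 0 p

------------------------------------------------------------------------
-- The grid.  An element of Fin n stands for the integer ⟦ x ⟧ ∈ {1,…,n}.

⟦_⟧ : Fin n → ℕ
⟦ x ⟧ = suc (toℕ x)

Point : ℕ → ℕ → Set
Point d n = Vec (Fin n) d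

ShareLineOfSight : ∀ {d} → Point d n → Point d n → Set
ShareLineOfSight p q = ∃! _≡_ λ h → lookup p h ≢ lookup q h

manhattan : ∀ {d} → Point d n → Point d n → ℕ
manhattan p q = sum (zipWith (λ x y → ∣ ⟦ x ⟧ - ⟦ y ⟧ ∣) p q)

------------------------------------------------------------------------
-- Subsets of Fin m as vertex sets of induced subgraphs.

-- The increasing enumeration of S.

element : (S : Subset m) → Fin ∣ S ∣ → Fin m
element (inside  ∷ S) zero    = zero
element (inside  ∷ S) (suc i) = suc (element S i)
element (outside ∷ S) i       = suc (element S i)

element-injective : (S : Subset m) → Injective _≡_ _≡_ (element S)
element-injective (inside  ∷ S) {zero}  {zero}  eq = refl
element-injective (inside  ∷ S) {suc i} {suc j} eq = cong suc (element-injective S (suc-injective eq))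
element-injective (outside ∷ S) eq = element-injective S (suc-injective eq)

-- The image under element S of a set T of positions.

imageᵗ : (S : Subset m) → Subset ∣ S ∣ → Timed (Subset m)
imageᵗ []            []      = step []
imageᵗ (inside  ∷ S) (t ∷ T) = do
  R ← imageᵗ S T
  step (t ∷ R)
imageᵗ (outside ∷ S) T       = do
  R ← imageᵗ S T
  step (outside ∷ R)

------------------------------------------------------------------------
-- The domain of weights: any linearly ordered abelian group, such as
-- the additive group of ℤ, ℚ or ℝ.  Decidability of the order is the
-- algorithm's ability to compare weights.

record OrderedAbelianGroup c ℓ₁ ℓ₂ : Set (lsuc (c ⊔ ℓ₁ ⊔ ℓ₂)) where
  field
    abelianGroup : AbelianGroup c ℓ₁
  open AbelianGroup abelianGroup public
    renaming (_∙_ to _⊕_; ε to 0#) using (Carrier; _≈_; rawMonoid)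
  infix 4 _≼_
  field
    _≼_             : Rel Carrier ℓ₂
    isDecTotalOrder : IsDecTotalOrder _≈_ _≼_
    ⊕-monoʳ-≼       : ∀ x {y z} → y ≼ z → (x ⊕ y) ≼ (x ⊕ z)
  open IsDecTotalOrder isDecTotalOrder public using () renaming (_≤?_ to _≼?_)
  open RawMonoidDefinitions rawMonoid public using () renaming (_×_ to _·_; sum to ∑)

  Positive : Carrier → Set (ℓ₁ ⊔ ℓ₂)
  Positive x = 0# ≼ x × ¬ (0# ≈ x)

module _ {c ℓ₁ ℓ₂} (W : OrderedAbelianGroup c ℓ₁ ℓ₂) where

  open OrderedAbelianGroup W

  record WeightedGraph : Set (lsuc Level.zero ⊔ c ⊔ ℓ₁ ⊔ ℓ₂) where
    field
      size   : ℕ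
      Adj    : Fin size → Fin size → Set
      symm   : Symmetric Adj
      irrefl : Irreflexive _≡_ Adj
      w      : Fin size → Carrier
      w-pos  : ∀ v → Positive (w v)

    IsIndependent : Subset size → Set
    IsIndependent S = ∀ {u v} → u ∈ S → v ∈ S → ¬ Adj u v

    weight : Subset size → Carrier
    weight S = ∑ λ v → if lookup S v then w v else 0#

    weightᵗ : Subset size → Timed Carrier
    weightᵗ S = foldrᵗ (λ x y → step (x ⊕ y)) (step 0#) λ v → do
      v∈S ← step (lookup S v)
      if v∈S then step (w v) else step 0#

    IsMaximumIndependentSet : Subset size → Set ℓ₂
    IsMaximumIndependentSet S = IsIndependent S × (∀ T → IsIndependent T → weight T ≼ weight S)

  inducedGraph : (G : WeightedGraph) → Subset (WeightedGraph.size G) → WeightedGraph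
  inducedGraph G S = record
    { size   = ∣ S ∣
    ; Adj    = λ u v → Adj (element S u) (element S v)
    ; symm   = symm
    ; irrefl = λ u≡v → irrefl (cong (element S) u≡v)
    ; w      = w ∘ element S
    ; w-pos  = w-pos ∘ element S
    }
    where open WeightedGraph G

  record LoSNetwork (d ω n : ℕ) : Set (lsuc Level.zero ⊔ c ⊔ ℓ₁ ⊔ ℓ₂) where
    field
      graph       : WeightedGraph
    open WeightedGraph graph public
    field
      f           : Fin size → Point d n
      f-injective : Injective _≡_ _≡_ f
      adjacency   : ∀ u v → Adj u v ⇔ (ShareLineOfSight (f u) (f v) × manhattan (f u) (f v) < ω)

  open LoSNetwork using (size)

  induced : ∀ {d ω n} (N : LoSNetwork d ω n) → Subset (size N) → LoSNetwork d ω n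
  induced N S = record
    { graph       = inducedGraph graph S
    ; f           = f ∘ element S
    ; f-injective = element-injective S ∘ f-injective
    ; adjacency   = λ u v → adjacency (element S u) (element S v)
    }
    where open LoSNetwork N hiding (size)

  VertexSetAlgorithm : ℕ → ℕ → Set (lsuc Level.zero ⊔ c ⊔ ℓ₁ ⊔ ℓ₂)
  VertexSetAlgorithm d ω = ∀ {n} (N : LoSNetwork d ω n) → Timed (Subset (size N))

  record IsMISApproximationAlgorithm (ρ d ω : ℕ) (alg : VertexSetAlgorithm d ω)
    : Set (lsuc Level.zero ⊔ c ⊔ ℓ₁ ⊔ ℓ₂) where
    field
      polynomialTime : ∃[ p ] ∀ {n} (N : LoSNetwork d ω n) → time (alg N) ≤ eval p n
      independent    : ∀ {n} (N : LoSNetwork d ω n) →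
                       LoSNetwork.IsIndependent N (value (alg N))
      ratio          : ∀ {n} (N : LoSNetwork d ω n) (O : Subset (size N)) →
                       LoSNetwork.IsMaximumIndependentSet N O →
                       LoSNetwork.weight N O ≼ ρ · LoSNetwork.weight N (value (alg N))

  module _ (d ω : ℕ) (2<ω : 2 < ω) where

    k : ℕ
    k = ω ∸ 1

    private
      instance
        k-nonZero : NonZero k
        k-nonZero = >-nonZero (m<n⇒0<n∸m (<-trans (n<1+n 1) 2<ω))

    ⌈_/k⌉ : ℕ → ℕ
    ⌈ n /k⌉ = (n + (k ∸ 1)) / k

    StripIndex : ℕ → Set
    StripIndex n = Vec (Fin ⌈ n /k⌉) (d ∸ 1)

    axis : Fin (d ∸ 1) → Fin d
    axis h = inject≤ h (m∸n≤m d 1)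

    InStrip : StripIndex n → Point d n → Set
    InStrip i p = ∀ h → ∃[ j ] ⟦ lookup p (axis h) ⟧ ≡ k * (⟦ lookup i h ⟧ ∸ 1) + ⟦_⟧ {k} j

    inStrip? : (i : StripIndex n) (p : Point d n) → Dec (InStrip i p)
    inStrip? i p = all? λ h → any? λ j → ⟦ lookup p (axis h) ⟧ ≟ℕ k * (⟦ lookup i h ⟧ ∸ 1) + ⟦ j ⟧

    stripVertices : (N : LoSNetwork d ω n) → StripIndex n → Subset (size N)
    stripVertices N i = tabulate λ v → does (inStrip? i (LoSNetwork.f N v))

    strip : LoSNetwork d ω n → StripIndex n → LoSNetwork d ω n
    strip N i = induced N (stripVertices N i)

    -- The exact dynamic programming algorithm for strips, known only
    -- through its specification: it is exact on every strip, and for the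
    -- fixed d and ω (hence k) its running time on strips is polynomial
    -- in n.

    record StripSolver : Set (lsuc Level.zero ⊔ c ⊔ ℓ₁ ⊔ ℓ₂) where
      field
        solve          : VertexSetAlgorithm d ω
        exact          : ∀ {n} (N : LoSNetwork d ω n) (i : StripIndex n) →
                         LoSNetwork.IsMaximumIndependentSet (strip N i) (value (solve (strip N i)))
        polynomialTime : ∃[ p ] ∀ {n} (N : LoSNetwork d ω n) (i : StripIndex n) →
                         time (solve (strip N i)) ≤ eval p n

    inStripᵗ : StripIndex n → Point d n → Timed Bool
    inStripᵗ i p = allᵗ λ h → anyᵗ {n = k} λ j → do
      x  ← step (lookup p (axis h))
      iₕ ← step (lookup i h)
      r  ← step (⟦ iₕ ⟧ ∸ 1)
      s  ← step (k * r)
      t  ← step (s + ⟦ j ⟧)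
      step (⟦ x ⟧ ≡ᵇ t)

    parityᵗ : StripIndex n → Timed Parity
    parityᵗ i = do
      s ← foldrᵗ (λ x y → step (x + y)) (step 0) (λ h → step ⟦ lookup i h ⟧)
      step (parity s)

    module _ (solver : StripSolver) where

      open StripSolver solver using (solve)

      solveStripᵗ : (N : LoSNetwork d ω n) → StripIndex n → Timed (Subset (size N))
      solveStripᵗ N i = do
        S ← tabulateᵗ (λ v → inStripᵗ i (LoSNetwork.f N v))
        -- Building the induced network copies at most one weight and d
        -- coordinates per vertex; its edges are implicit in the embedding.
        spend (size N * suc d)
        T ← solve (induced N S)
        imageᵗ S T

      solveStripsᵗ : Parity → (N : LoSNetwork d ω n) → Timed (Subset (size N))
      solveStripsᵗ {n = n} π N = ⋃ᵗ ⌈ n /k⌉ (d ∸ 1) λ i → do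
        πᵢ ← parityᵗ {n = n} i
        b  ← step (does (πᵢ ≟ℙ π))
        if b then solveStripᵗ N i else ∅ᵗ

      stripIndependentSet : VertexSetAlgorithm d ω
      stripIndependentSet N = do
        odd   ← solveStripsᵗ 1ℙ N
        even  ← solveStripsᵗ 0ℙ N
        wodd  ← LoSNetwork.weightᵗ N odd
        weven ← LoSNetwork.weightᵗ N even
        b     ← step (does (weven ≼? wodd))
        step (if b then odd else even)

{-# OPTIONS --safe #-}

-- Two points on a common line of sight that lie in different strips differ
-- only in a coordinate h < d, so their strip indices differ only at h; if
-- the strips have the same parity these indices are at least 2 apart, which
-- puts the points at distance more than k = ω − 1.  Hence strips of equal
-- parity do not interact, and the union of their optimal independent sets is
-- independent and at least as heavy as the part of any independent set lying
-- in them.  As every vertex lies in an odd or in an even strip, the heavier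
-- union has at least half of the optimal weight.  The time bound rests on
-- |V| ≤ nᵈ, by injectivity of the embedding.

module Submission where

open import Defs
open import Algebra.Bundles using (AbelianGroup)
import Algebra.Properties.CommutativeMonoid.Sum as Sum
open import Data.Bool.Base using (Bool; true; false; _∧_; _∨_; if_then_else_)
open import Data.Bool.Properties using (if-float)
open import Data.Empty using (⊥-elim)
open import Data.Fin.Base using (Fin; zero; suc; toℕ; fromℕ<; funToFin; finToFun)
open import Data.Fin.Properties using (any?; all?; suc-injective; toℕ<n; toℕ-injective; toℕ-fromℕ<; inject≤-injective; injective⇒≤; finToFun-funToFin) renaming (_≟_ to _≟ᶠ_)
open import Data.Fin.Subset using (Subset; inside; outside; _∈_; ∣_∣; _∪_; ⊥)
open import Data.Fin.Subset.Properties using (x∈p∪q⁺; x∈p∪q⁻; ∉⊥)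
open import Data.List.Base using (List; []; _∷_; map)
open import Data.Nat.Base using (ℕ; zero; suc; _+_; _*_; _∸_; _^_; _≤_; _<_; s≤s; s≤s⁻¹; ∣_-_∣; _≡ᵇ_; NonZero; parity; >-nonZero)
open import Data.Nat.DivMod using (_/_; _%_; m/n≤m; m≡m%n+[m/n]*n; m%n<n; n/n≡1; /-monoˡ-≤; +-distrib-/-∣ʳ)
open import Data.Nat.Divisibility using (∣-refl)
open import Data.Nat.Properties using (module ≤-Reasoning; ≤-refl; ≤-reflexive; ≤-trans; ≤-antisym; <-trans; n<1+n; m<n⇒0<n∸m; m≤m+n; m≤n+m; m≤n⇒m≤o+n; +-mono-≤; +-monoˡ-≤; +-monoʳ-≤; +-monoˡ-<; +-monoʳ-<; *-mono-≤; *-monoˡ-≤; +-comm; +-assoc; +-suc; +-identityʳ; *-comm; *-zeroʳ; *-identityʳ; *-cancelˡ-<; m≤n+∣m-n∣; m≤n+∣n-m∣; ∸-monoˡ-≤) renaming (suc-injective to sucℕ-injective; _≟_ to _≟ℕ_)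
open import Data.Nat.Solver using (module +-*-Solver)
open import Data.Parity.Base using (Parity; 0ℙ; 1ℙ; _⁻¹) renaming (_+_ to _ℙ+_)
open import Data.Parity.Properties using (suc-homo-⁻¹; +-homo-+; +-cancelˡ-≡) renaming (_≟_ to _≟ℙ_)
open import Data.Product.Base using (_×_; _,_; proj₁; proj₂; ∃-syntax)
open import Data.Sum.Base using (_⊎_; inj₁; inj₂)
open import Data.Vec.Base using (Vec; []; _∷_; lookup; tabulate; here; there)
open import Data.Vec.Properties using (∷-injectiveˡ; ∷-injectiveʳ; []=⇒lookup; lookup⇒[]=; lookup∘tabulate; tabulate∘lookup; tabulate-cong)
open import Function.Base using (_∘_)
open import Function.Bundles using (Equivalence)
open import Function.Definitions using (Injective)
open import Level using (Level)
open import Relation.Binary.Bundles using (Poset)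
import Relation.Binary.Reasoning.PartialOrder as PartialOrderReasoning
open import Relation.Binary.PropositionalEquality using (_≡_; _≢_; _≗_; refl; sym; trans; cong; cong₂; subst; subst₂; module ≡-Reasoning)
open import Relation.Binary.Structures using (IsDecTotalOrder)
open import Relation.Nullary.Decidable.Core using (Dec; does; yes; no)
open import Relation.Nullary.Decidable using (dec-true)
open import Relation.Nullary.Negation.Core using (¬_; contradiction)
open import Relation.Unary using (Pred; Decidable)

private
  variable
    a b : Level
    A : Set a
    B : Set b
    m n : ℕ

-- Polynomial bounds

PolynomiallyBounded : (ℕ → ℕ) → Set
PolynomiallyBounded t = ∃[ p ] ∀ n → t n ≤ eval p n

infixl 6 _+ᵖ_
infixl 7 _*ᵖ_

_+ᵖ_ : List ℕ → List ℕ → List ℕ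
[]      +ᵖ q       = q
(c ∷ p) +ᵖ []      = c ∷ p
(c ∷ p) +ᵖ (e ∷ q) = c + e ∷ (p +ᵖ q)

_*ᵖ_ : List ℕ → List ℕ → List ℕ
[]      *ᵖ q = []
(c ∷ p) *ᵖ q = map (c *_) q +ᵖ (0 ∷ p *ᵖ q)

eval-+ᵖ : ∀ p q x → eval (p +ᵖ q) x ≡ eval p x + eval q x
eval-+ᵖ []      q       x = refl
eval-+ᵖ (c ∷ p) []      x = sym (+-identityʳ _)
eval-+ᵖ (c ∷ p) (e ∷ q) x rewrite eval-+ᵖ p q x =
  solve 5 (λ c e x P Q → c :+ e :+ x :* (P :+ Q) := c :+ x :* P :+ (e :+ x :* Q))
    refl c e x (eval p x) (eval q x)
  where open +-*-Solver

eval-map-* : ∀ c q x → eval (map (c *_) q) x ≡ c * eval q x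
eval-map-* c []      x = sym (*-zeroʳ c)
eval-map-* c (e ∷ q) x rewrite eval-map-* c q x =
  solve 4 (λ c e x Q → c :* e :+ x :* (c :* Q) := c :* (e :+ x :* Q)) refl c e x (eval q x)
  where open +-*-Solver

eval-*ᵖ : ∀ p q x → eval (p *ᵖ q) x ≡ eval p x * eval q x
eval-*ᵖ []      q x = refl
eval-*ᵖ (c ∷ p) q x
  rewrite eval-+ᵖ (map (c *_) q) (0 ∷ p *ᵖ q) x | eval-map-* c q x | eval-*ᵖ p q x =
  solve 4 (λ c x P Q → c :* Q :+ x :* (P :* Q) := (c :+ x :* P) :* Q)
    refl c x (eval p x) (eval q x)
  where open +-*-Solver

poly-const : ∀ c → PolynomiallyBounded (λ _ → c)
poly-const c = c ∷ [] , λ n → m≤m+n c (n * 0)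

poly-id : PolynomiallyBounded (λ n → n)
poly-id = 0 ∷ 1 ∷ [] , λ n → ≤-reflexive
  (solve 1 (λ n → n := n :* (con 1 :+ n :* con 0)) refl n)
  where open +-*-Solver

poly-+ : ∀ {s t} → PolynomiallyBounded s → PolynomiallyBounded t →
         PolynomiallyBounded (λ n → s n + t n)
poly-+ (p , s≤p) (q , t≤q) = p +ᵖ q , λ n →
  ≤-trans (+-mono-≤ (s≤p n) (t≤q n)) (≤-reflexive (sym (eval-+ᵖ p q n)))

poly-* : ∀ {s t} → PolynomiallyBounded s → PolynomiallyBounded t →
         PolynomiallyBounded (λ n → s n * t n)
poly-* (p , s≤p) (q , t≤q) = p *ᵖ q , λ n →
  ≤-trans (*-mono-≤ (s≤p n) (t≤q n)) (≤-reflexive (sym (eval-*ᵖ p q n)))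

poly-^ : ∀ e → PolynomiallyBounded (_^ e)
poly-^ zero    = poly-const 1
poly-^ (suc e) = poly-* poly-id (poly-^ e)

-- Values and running times of the basic computations

value-tabulateᵗ : (f : Fin n → Timed A) → value (tabulateᵗ f) ≡ tabulate (value ∘ f)
value-tabulateᵗ {n = zero}  f = refl
value-tabulateᵗ {n = suc n} f = cong (value (f zero) ∷_) (value-tabulateᵗ (f ∘ suc))

value-∅ᵗ : ∀ m → value (∅ᵗ {m}) ≡ ⊥
value-∅ᵗ zero    = refl
value-∅ᵗ (suc m) = cong (outside ∷_) (value-∅ᵗ m)

value-∪ᵗ : (S T : Subset m) → value (S ∪ᵗ T) ≡ S ∪ T
value-∪ᵗ []      []      = refl
value-∪ᵗ (s ∷ S) (t ∷ T) = cong ((s ∨ t) ∷_) (value-∪ᵗ S T)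

value-anyᵗ : ∀ {p} {P : Pred (Fin n) p} (P? : Decidable P) (f : Fin n → Timed Bool) →
             (∀ i → value (f i) ≡ does (P? i)) → value (anyᵗ f) ≡ does (any? P?)
value-anyᵗ {n = zero}  P? f eq = refl
value-anyᵗ {n = suc n} P? f eq = cong₂ _∨_ (eq zero) (value-anyᵗ (P? ∘ suc) (f ∘ suc) (eq ∘ suc))

value-allᵗ : ∀ {p} {P : Pred (Fin n) p} (P? : Decidable P) (f : Fin n → Timed Bool) →
             (∀ i → value (f i) ≡ does (P? i)) → value (allᵗ f) ≡ does (all? P?)
value-allᵗ {n = zero}  P? f eq = refl
value-allᵗ {n = suc n} P? f eq = cong₂ _∧_ (eq zero) (value-allᵗ (P? ∘ suc) (f ∘ suc) (eq ∘ suc))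

-- The length is bounded by a separate `M` because the vectors are indexed by vertices, while
-- running times must be measured in the side of the grid.
time-tabulateᵗ-≤ : ∀ {M t} (f : Fin n → Timed A) → n ≤ M → (∀ i → time (f i) ≤ t) →
                   time (tabulateᵗ f) ≤ M * (t + 1) + 1
time-tabulateᵗ-≤ {n = n} {M = M} {t} f n≤M f≤t =
  ≤-trans (exact f f≤t) (+-monoˡ-≤ 1 (*-monoˡ-≤ (t + 1) n≤M))
  where
  open +-*-Solver
  exact : ∀ {n} (f : Fin n → Timed _) → (∀ i → time (f i) ≤ t) → time (tabulateᵗ f) ≤ n * (t + 1) + 1
  exact {zero}  f f≤t = ≤-refl
  exact {suc n} f f≤t = ≤-trans
    (+-mono-≤ (f≤t zero) (+-monoˡ-≤ 1 (exact (f ∘ suc) (f≤t ∘ suc))))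
    (≤-reflexive (solve 2 (λ t x → t :+ (x :+ con 1 :+ con 1) := t :+ con 1 :+ x :+ con 1)
      refl t (n * (t + 1))))

time-foldrᵗ-≤ : ∀ {M s t u} {_∙_ : A → B → Timed B} {e : Timed B} (f : Fin n → Timed A) → n ≤ M →
                (∀ x y → time (x ∙ y) ≤ s) → time e ≤ u → (∀ i → time (f i) ≤ t) →
                time (foldrᵗ _∙_ e f) ≤ M * (t + s) + u
time-foldrᵗ-≤ {n = n} {M = M} {s} {t} {u} {_∙_} {e} f n≤M ∙≤s e≤u f≤t =
  ≤-trans (exact f f≤t) (+-monoˡ-≤ u (*-monoˡ-≤ (t + s) n≤M))
  where
  open +-*-Solver
  exact : ∀ {n} (f : Fin n → Timed _) → (∀ i → time (f i) ≤ t) → time (foldrᵗ _∙_ e f) ≤ n * (t + s) + u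
  exact {zero}  f f≤t = e≤u
  exact {suc n} f f≤t = ≤-trans
    (+-mono-≤ (f≤t zero) (+-mono-≤ (exact (f ∘ suc) (f≤t ∘ suc)) (∙≤s _ _)))
    (≤-reflexive (solve 4 (λ t s u x → t :+ (x :+ u :+ s) := t :+ s :+ x :+ u)
      refl t s u (n * (t + s))))

time-∅ᵗ-≤ : ∀ {M} → m ≤ M → time (∅ᵗ {m}) ≤ M * 2 + 1
time-∅ᵗ-≤ m≤M = time-tabulateᵗ-≤ _ m≤M (λ _ → ≤-refl)

time-∪ᵗ-≤ : ∀ {M} → m ≤ M → (S T : Subset m) → time (S ∪ᵗ T) ≤ M * 4 + 1
time-∪ᵗ-≤ m≤M S T = time-tabulateᵗ-≤ _ m≤M (λ _ → ≤-refl)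

time-imageᵗ : (S : Subset m) (T : Subset ∣ S ∣) → time (imageᵗ S T) ≡ m + 1
time-imageᵗ []            []      = refl
time-imageᵗ (inside  ∷ S) (t ∷ T) = trans (+-comm _ 1) (cong suc (time-imageᵗ S T))
time-imageᵗ (outside ∷ S) T       = trans (+-comm _ 1) (cong suc (time-imageᵗ S T))

-- Follows the recursion of `⋃ᵗ`: on each level every branch is followed by one `_∪ᵗ_`, and the fold
-- starts from one `∅ᵗ`.
⋃-time : (q e M t : ℕ) → ℕ
⋃-time q zero    M t = t
⋃-time q (suc e) M t = q * (⋃-time q e M t + (M * 4 + 1)) + (M * 2 + 1)

time-⋃ᵗ-≤ : ∀ {q Q M t} e (F : Vec (Fin q) e → Timed (Subset m)) → q ≤ Q → m ≤ M →
            (∀ i → time (F i) ≤ t) → time (⋃ᵗ q e F) ≤ ⋃-time Q e M t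
time-⋃ᵗ-≤ zero    F q≤Q m≤M F≤t = F≤t []
time-⋃ᵗ-≤ (suc e) F q≤Q m≤M F≤t =
  time-foldrᵗ-≤ _ q≤Q (time-∪ᵗ-≤ m≤M) (time-∅ᵗ-≤ m≤M)
    (λ x → time-⋃ᵗ-≤ e (λ xs → F (x ∷ xs)) q≤Q m≤M (λ xs → F≤t (x ∷ xs)))

-- The depth `e` does not vary with the argument, so the recurrence unfolds to a fixed number of
-- sums and products.
poly-⋃-time : ∀ {q M t} e → PolynomiallyBounded q → PolynomiallyBounded M → PolynomiallyBounded t →
              PolynomiallyBounded (λ n → ⋃-time (q n) e (M n) (t n))
poly-⋃-time zero    q M t = t
poly-⋃-time (suc e) q M t = poly-+
  (poly-* q (poly-+ (poly-⋃-time e q M t) (poly-+ (poly-* M (poly-const 4)) (poly-const 1))))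
  (poly-+ (poly-* M (poly-const 2)) (poly-const 1))

time-if-≤ : ∀ {s t} b {x y : Timed A} → time x ≤ s → time y ≤ t →
            time (if b then x else y) ≤ s + t
time-if-≤ {s = s} {t} true  x≤s y≤t = ≤-trans x≤s (m≤m+n s t)
time-if-≤ {s = s} {t} false x≤s y≤t = ≤-trans y≤t (m≤n+m t s)

-- Unions and images of subsets

∈-∪ᵗ⁻ : ∀ {v} (S T : Subset m) → v ∈ value (S ∪ᵗ T) → v ∈ S ⊎ v ∈ T
∈-∪ᵗ⁻ S T v∈ = x∈p∪q⁻ S T (subst (_ ∈_) (value-∪ᵗ S T) v∈)

∈-∪ᵗ⁺ : ∀ {v} (S T : Subset m) → v ∈ S ⊎ v ∈ T → v ∈ value (S ∪ᵗ T)
∈-∪ᵗ⁺ S T v∈ = subst (_ ∈_) (sym (value-∪ᵗ S T)) (x∈p∪q⁺ v∈)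

∉-∅ᵗ : ∀ {v} → ¬ v ∈ value (∅ᵗ {m})
∉-∅ᵗ {m} v∈ = ∉⊥ (subst (_ ∈_) (value-∅ᵗ m) v∈)

∈-unionᵗ⁻ : ∀ {q v} (F : Fin q → Timed (Subset m)) →
            v ∈ value (foldrᵗ _∪ᵗ_ ∅ᵗ F) → ∃[ x ] v ∈ value (F x)
∈-unionᵗ⁻ {m} {zero}  F v∈ = contradiction v∈ ∉-∅ᵗ
∈-unionᵗ⁻ {m} {suc q} F v∈ with ∈-∪ᵗ⁻ (value (F zero)) _ v∈
... | inj₁ v∈F₀ = zero , v∈F₀
... | inj₂ v∈F₊ with x , v∈Fx ← ∈-unionᵗ⁻ (F ∘ suc) v∈F₊ = suc x , v∈Fx

∈-unionᵗ⁺ : ∀ {q v} (F : Fin q → Timed (Subset m)) x →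
            v ∈ value (F x) → v ∈ value (foldrᵗ _∪ᵗ_ ∅ᵗ F)
∈-unionᵗ⁺ F zero    v∈ = ∈-∪ᵗ⁺ (value (F zero)) (value (foldrᵗ _∪ᵗ_ ∅ᵗ (F ∘ suc))) (inj₁ v∈)
∈-unionᵗ⁺ F (suc x) v∈ = ∈-∪ᵗ⁺ (value (F zero)) _ (inj₂ (∈-unionᵗ⁺ (F ∘ suc) x v∈))

∈-⋃ᵗ⁻ : ∀ {q v} e (F : Vec (Fin q) e → Timed (Subset m)) →
        v ∈ value (⋃ᵗ q e F) → ∃[ i ] v ∈ value (F i)
∈-⋃ᵗ⁻ zero    F v∈ = [] , v∈
∈-⋃ᵗ⁻ (suc e) F v∈ with x , v∈x ← ∈-unionᵗ⁻ _ v∈ with xs , v∈xs ← ∈-⋃ᵗ⁻ e (λ xs → F (x ∷ xs)) v∈x =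
  x ∷ xs , v∈xs

∈-⋃ᵗ⁺ : ∀ {q v} e (F : Vec (Fin q) e → Timed (Subset m)) i →
        v ∈ value (F i) → v ∈ value (⋃ᵗ q e F)
∈-⋃ᵗ⁺ zero    F []       v∈ = v∈
∈-⋃ᵗ⁺ (suc e) F (x ∷ xs) v∈ = ∈-unionᵗ⁺ _ x (∈-⋃ᵗ⁺ e (λ xs → F (x ∷ xs)) xs v∈)

-- The value of the guarded loop body of `solveStripsᵗ` reduces to this form, so the same lemmas
-- serve the algorithm and the set it is compared with.
whenᵗ : ∀ {p} {P : Set p} → Dec P → Timed (Subset m) → Timed (Subset m)
whenᵗ P? F = if does P? then F else ∅ᵗ

∈-whenᵗ⁻ : ∀ {p} {P : Set p} {v} (P? : Dec P) (F : Timed (Subset m)) →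
           v ∈ value (whenᵗ P? F) → P × v ∈ value F
∈-whenᵗ⁻ (yes p) F v∈ = p , v∈
∈-whenᵗ⁻ (no ¬p) F v∈ = contradiction v∈ ∉-∅ᵗ

∈-whenᵗ⁺ : ∀ {p} {P : Set p} {v} (P? : Dec P) (F : Timed (Subset m)) →
           P → v ∈ value F → v ∈ value (whenᵗ P? F)
∈-whenᵗ⁺ (yes _) F p v∈ = v∈
∈-whenᵗ⁺ (no ¬p) F p v∈ = contradiction p ¬p

∈-imageᵗ⁻ : ∀ {v} (S : Subset m) T → v ∈ value (imageᵗ S T) → ∃[ i ] i ∈ T × element S i ≡ v
∈-imageᵗ⁻ (inside ∷ S) (inside ∷ T) here = zero , here , refl
∈-imageᵗ⁻ (inside ∷ S) (t ∷ T) (there v∈) with i , i∈T , refl ← ∈-imageᵗ⁻ S T v∈ =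
  suc i , there i∈T , refl
∈-imageᵗ⁻ (outside ∷ S) T (there v∈) with i , i∈T , refl ← ∈-imageᵗ⁻ S T v∈ = i , i∈T , refl

element-∈ : (S : Subset m) (i : Fin ∣ S ∣) → element S i ∈ S
element-∈ (inside  ∷ S) zero    = here
element-∈ (inside  ∷ S) (suc i) = there (element-∈ S i)
element-∈ (outside ∷ S) i       = there (element-∈ S i)

-- The trace of `O` on `S` as a vertex set of the graph induced by `S`; `imageᵗ S` sends it back to
-- the intersection of `S` and `O`.
restrict : (S : Subset m) → Subset m → Subset ∣ S ∣
restrict S O = tabulate (lookup O ∘ element S)

∈-restrict⁻ : ∀ (S O : Subset m) {i} → i ∈ restrict S O → element S i ∈ O
∈-restrict⁻ S O {i} i∈ =
  lookup⇒[]= _ O (trans (sym (lookup∘tabulate (lookup O ∘ element S) i)) ([]=⇒lookup i∈))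

∈-imageᵗ-restrict⁺ : ∀ {v} (S O : Subset m) → v ∈ S → v ∈ O → v ∈ value (imageᵗ S (restrict S O))
∈-imageᵗ-restrict⁺ (inside  ∷ S) (inside ∷ O) here        here        = here
∈-imageᵗ-restrict⁺ (inside  ∷ S) (_ ∷ O)      (there v∈S) (there v∈O) = there (∈-imageᵗ-restrict⁺ S O v∈S v∈O)
∈-imageᵗ-restrict⁺ (outside ∷ S) (_ ∷ O)      (there v∈S) (there v∈O) = there (∈-imageᵗ-restrict⁺ S O v∈S v∈O)

-- The grid

lookup-extensional : ∀ (xs ys : Vec A n) → lookup xs ≗ lookup ys → xs ≡ ys
lookup-extensional xs ys eq =
  trans (sym (tabulate∘lookup xs)) (trans (tabulate-cong eq) (tabulate∘lookup ys))

-- `funToFin` codes a point, read as a function from axes to coordinates, by a number below `n ^ d`.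
-- Decoding recovers every coordinate, so the coded embedding is still injective.
injection-into-grid⇒≤ : ∀ {d} {f : Fin m → Point d n} → Injective _≡_ _≡_ f → m ≤ n ^ d
injection-into-grid⇒≤ {f = f} f-inj = injective⇒≤ {f = funToFin ∘ lookup ∘ f} λ {u} {v} eq →
  f-inj (lookup-extensional (f u) (f v) λ h →
    trans (sym (finToFun-funToFin (lookup (f u)) h))
      (trans (cong (λ c → finToFun c h) eq) (finToFun-funToFin (lookup (f v)) h)))

coordinate-distance-≤-manhattan : ∀ {d} (p q : Point d n) h →
  ∣ toℕ (lookup p h) - toℕ (lookup q h) ∣ ≤ manhattan p q
coordinate-distance-≤-manhattan (x ∷ p) (y ∷ q) zero    = m≤m+n _ _
coordinate-distance-≤-manhattan (x ∷ p) (y ∷ q) (suc h) =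
  m≤n⇒m≤o+n ∣ toℕ x - toℕ y ∣ (coordinate-distance-≤-manhattan p q h)

-- If `b` exceeded `a + r`, then `k * b` would be at least `k * a + k + k * r`, too much because the
-- offset `i` is less than `k`. The case `r = 0` serves equal coordinates, `r = 1` coordinates at
-- most `k` apart.
block-≤ : ∀ k {a b i j r} → i < k → k * b + j ≤ k * a + i + k * r → b ≤ a + r
block-≤ k {a} {b} {i} {j} {r} i<k le = s≤s⁻¹ (*-cancelˡ-< k b (suc (a + r)) (begin-strict
  k * b                ≤⟨ m≤m+n _ j ⟩
  k * b + j            ≤⟨ le ⟩
  k * a + i + k * r    <⟨ +-monoˡ-< (k * r) (+-monoʳ-< (k * a) i<k) ⟩
  k * a + k + k * r    ≡⟨ solve 3 (λ k a r → k :* a :+ k :+ k :* r := k :* (con 1 :+ (a :+ r))) refl k a r ⟩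
  k * suc (a + r)      ∎))
  where
  open ≤-Reasoning
  open +-*-Solver

-- Adding `k` to `x` raises the quotient by one, and `x + k` is at most `n + (k ∸ 1)`. Quotients of
-- zero-based coordinates are thus valid components of a strip index.
/-<-ceiling : ∀ k .{{_ : NonZero k}} {x} → x < n → x / k < (n + (k ∸ 1)) / k
/-<-ceiling {n} k@(suc k-1) {x} x<n = begin
  suc (x / k)        ≡⟨ +-comm 1 (x / k) ⟩
  x / k + 1          ≡⟨ cong (x / k +_) (n/n≡1 k) ⟨
  x / k + k / k      ≡⟨ +-distrib-/-∣ʳ x (∣-refl {k}) ⟨
  (x + k) / k        ≤⟨ /-monoˡ-≤ k (≤-trans (≤-reflexive (+-suc x k-1)) (+-monoˡ-≤ k-1 x<n)) ⟩
  (n + (k ∸ 1)) / k  ∎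
  where open ≤-Reasoning

-- Parity of sums of strip indices

parity-suc-injective : ∀ {x y} → parity (suc x) ≡ parity (suc y) → parity x ≡ parity y
parity-suc-injective {x} {y} eq = trans (sym (suc-homo-⁻¹ x)) (trans (cong _⁻¹ eq) (suc-homo-⁻¹ y))

-- Descending in both arguments flips both parities, so their equality survives until one argument
-- is zero; there parity excludes the gap 1 and the bounds exclude larger gaps.
close∧same-parity⇒≡ : ∀ {x y} → x ≤ suc y → y ≤ suc x → parity x ≡ parity y → x ≡ y
close∧same-parity⇒≡ {zero}        {zero}        _  _  _  = refl
close∧same-parity⇒≡ {zero}        {suc zero}    _  _  ()
close∧same-parity⇒≡ {suc zero}    {zero}        _  _  ()
close∧same-parity⇒≡ {zero}        {suc (suc y)} _  (s≤s ()) _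
close∧same-parity⇒≡ {suc (suc x)} {zero}        (s≤s ()) _  _
close∧same-parity⇒≡ {suc x}       {suc y} x≤ y≤ eq =
  cong suc (close∧same-parity⇒≡ (s≤s⁻¹ x≤) (s≤s⁻¹ y≤) (parity-suc-injective {x} {y} eq))

-- The fold inside `parityᵗ`, so that the parity of a strip index is by computation the parity of
-- such a sum.
sumᵗ : (Fin n → ℕ) → Timed ℕ
sumᵗ f = foldrᵗ (λ x y → step (x + y)) (step 0) (step ∘ f)

sumᵗ-cong : {f g : Fin n → ℕ} → f ≗ g → value (sumᵗ f) ≡ value (sumᵗ g)
sumᵗ-cong {n = zero}  eq = refl
sumᵗ-cong {n = suc n} eq = cong₂ _+_ (eq zero) (sumᵗ-cong (eq ∘ suc))

-- Both sides are the common sum off `h` plus `f h` plus `g h`; this form avoids subtraction.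
sumᵗ-exchange : ∀ {f g : Fin n → ℕ} h → (∀ h′ → h′ ≢ h → f h′ ≡ g h′) →
                value (sumᵗ f) + g h ≡ value (sumᵗ g) + f h
sumᵗ-exchange {f = f} {g} zero eq
  rewrite sumᵗ-cong {f = f ∘ suc} {g ∘ suc} (λ h′ → eq (suc h′) λ ()) =
  solve 3 (λ x y s → x :+ s :+ y := y :+ s :+ x) refl (f zero) (g zero) (value (sumᵗ (g ∘ suc)))
  where open +-*-Solver
sumᵗ-exchange {f = f} {g} (suc h) eq
  rewrite eq zero (λ ())
        | +-assoc (g zero) (value (sumᵗ (f ∘ suc))) (g (suc h))
        | +-assoc (g zero) (value (sumᵗ (g ∘ suc))) (f (suc h)) =
  cong (g zero +_) (sumᵗ-exchange h (λ h′ h′≢h → eq (suc h′) (h′≢h ∘ suc-injective)))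

-- Take parities in `sumᵗ-exchange` and cancel the equal parities of the two sums.
sumᵗ-same-parity : ∀ {f g : Fin n → ℕ} h → (∀ h′ → h′ ≢ h → f h′ ≡ g h′) →
                   parity (value (sumᵗ f)) ≡ parity (value (sumᵗ g)) → parity (f h) ≡ parity (g h)
sumᵗ-same-parity {f = f} {g} h eq same = sym (+-cancelˡ-≡ (parity (value (sumᵗ f))) _ _ (begin
  parity F ℙ+ parity (g h)   ≡⟨ +-homo-+ F (g h) ⟨
  parity (F + g h)           ≡⟨ cong parity (sumᵗ-exchange h eq) ⟩
  parity (G + f h)           ≡⟨ +-homo-+ G (f h) ⟩
  parity G ℙ+ parity (f h)   ≡⟨ cong (_ℙ+ parity (f h)) same ⟨
  parity F ℙ+ parity (f h)   ∎))
  where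
  open ≡-Reasoning
  F = value (sumᵗ f)
  G = value (sumᵗ g)

-- Weights

module _ {c ℓ₁ ℓ₂} (W : OrderedAbelianGroup c ℓ₁ ℓ₂) where

  open OrderedAbelianGroup W
  open AbelianGroup abelianGroup using (commutativeMonoid; comm; identityˡ; identityʳ; ∙-congˡ) renaming (refl to ≈-refl; sym to ≈-sym; trans to ≈-trans)
  open Sum commutativeMonoid using (∑-distrib-+)

  weightPoset : Poset c ℓ₁ ℓ₂
  weightPoset = record { isPartialOrder = IsDecTotalOrder.isPartialOrder isDecTotalOrder }

  open Poset weightPoset using () renaming (refl to ≼-refl; reflexive to ≼-reflexive; trans to ≼-trans)
  open PartialOrderReasoning weightPoset

  ⊕-mono-≼ : ∀ {x y u v} → x ≼ y → u ≼ v → (x ⊕ u) ≼ (y ⊕ v)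
  ⊕-mono-≼ {x} {y} {u} {v} x≼y u≼v = begin
    x ⊕ u  ≤⟨ ⊕-monoʳ-≼ x u≼v ⟩
    x ⊕ v  ≈⟨ comm x v ⟩
    v ⊕ x  ≤⟨ ⊕-monoʳ-≼ v x≼y ⟩
    v ⊕ y  ≈⟨ comm v y ⟩
    y ⊕ v  ∎

  ∑-mono-≼ : {f g : Fin n → Carrier} → (∀ v → f v ≼ g v) → ∑ f ≼ ∑ g
  ∑-mono-≼ {n = zero}  f≼g = ≼-refl
  ∑-mono-≼ {n = suc n} f≼g = ⊕-mono-≼ (f≼g zero) (∑-mono-≼ (f≼g ∘ suc))

  infix 8 [_]_

  [_]_ : Bool → Carrier → Carrier
  [ b ] x = if b then x else 0#

  []-nonneg : ∀ b {x} → 0# ≼ x → 0# ≼ [ b ] x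
  []-nonneg true  0≼x = 0≼x
  []-nonneg false 0≼x = ≼-refl

  []-subadditive : ∀ s a b {x} → 0# ≼ x → (s ≡ true → a ≡ true ⊎ b ≡ true) → [ s ] x ≼ ([ a ] x ⊕ [ b ] x)
  []-subadditive false a b 0≼x _ =
    ≼-trans (≼-reflexive (≈-sym (identityˡ 0#))) (⊕-mono-≼ ([]-nonneg a 0≼x) ([]-nonneg b 0≼x))
  []-subadditive true true b 0≼x _ =
    ≼-trans (≼-reflexive (≈-sym (identityʳ _))) (⊕-monoʳ-≼ _ ([]-nonneg b 0≼x))
  []-subadditive true false true  0≼x _ = ≼-reflexive (≈-sym (identityˡ _))
  []-subadditive true false false 0≼x s⇒a∨b with s⇒a∨b refl
  ... | inj₁ ()
  ... | inj₂ ()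

  []-superadditive : ∀ s a b {x} → 0# ≼ x → (a ≡ true → s ≡ true) → (b ≡ true → s ≡ true) →
                     ¬ (a ≡ true × b ≡ true) → ([ a ] x ⊕ [ b ] x) ≼ [ s ] x
  []-superadditive s     true  true  0≼x a⇒s b⇒s a∦b = ⊥-elim (a∦b (refl , refl))
  []-superadditive s     false false 0≼x a⇒s b⇒s a∦b = ≼-trans (≼-reflexive (identityˡ 0#)) ([]-nonneg s 0≼x)
  []-superadditive true  true  false 0≼x a⇒s b⇒s a∦b = ≼-reflexive (identityʳ _)
  []-superadditive true  false true  0≼x a⇒s b⇒s a∦b = ≼-reflexive (identityˡ _)
  []-superadditive false true  false 0≼x a⇒s b⇒s a∦b = contradiction (a⇒s refl) λ ()
  []-superadditive false false true  0≼x a⇒s b⇒s a∦b = contradiction (b⇒s refl) λ ()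

  -- Entries `outside` of `S` contribute `0#`, so a vertex set of an induced graph weighs as much
  -- there as its image does in the whole graph.
  ∑-imageᵗ : (w : Fin m → Carrier) (S : Subset m) (T : Subset ∣ S ∣) →
             ∑ (λ v → [ lookup (value (imageᵗ S T)) v ] w v) ≈ ∑ (λ i → [ lookup T i ] w (element S i))
  ∑-imageᵗ w []            []      = ≈-refl
  ∑-imageᵗ w (inside  ∷ S) (t ∷ T) = ∙-congˡ (∑-imageᵗ (w ∘ suc) S T)
  ∑-imageᵗ w (outside ∷ S) T       = ≈-trans (identityˡ _) (∑-imageᵗ (w ∘ suc) S T)

  module _ (G : WeightedGraph W) where

    open WeightedGraph G

    weight-subadditive : ∀ S A B → (∀ {v} → v ∈ S → v ∈ A ⊎ v ∈ B) → weight S ≼ (weight A ⊕ weight B)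
    weight-subadditive S A B S⊆A∪B = ≼-trans
      (∑-mono-≼ λ v → []-subadditive (lookup S v) (lookup A v) (lookup B v) (proj₁ (w-pos v)) (cover v))
      (≼-reflexive (∑-distrib-+ (λ v → [ lookup A v ] w v) (λ v → [ lookup B v ] w v)))
      where
      cover : ∀ v → lookup S v ≡ true → lookup A v ≡ true ⊎ lookup B v ≡ true
      cover v eq with S⊆A∪B (lookup⇒[]= v S eq)
      ... | inj₁ v∈A = inj₁ ([]=⇒lookup v∈A)
      ... | inj₂ v∈B = inj₂ ([]=⇒lookup v∈B)

    weight-superadditive : ∀ S A B → (∀ {v} → v ∈ A ⊎ v ∈ B → v ∈ S) → (∀ {v} → v ∈ A → ¬ v ∈ B) →
                           (weight A ⊕ weight B) ≼ weight S
    weight-superadditive S A B A∪B⊆S A∦B = ≼-trans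
      (≼-reflexive (≈-sym (∑-distrib-+ (λ v → [ lookup A v ] w v) (λ v → [ lookup B v ] w v))))
      (∑-mono-≼ λ v → []-superadditive (lookup S v) (lookup A v) (lookup B v) (proj₁ (w-pos v))
        (λ eq → []=⇒lookup (A∪B⊆S (inj₁ (lookup⇒[]= v A eq))))
        (λ eq → []=⇒lookup (A∪B⊆S (inj₂ (lookup⇒[]= v B eq))))
        (λ (eqA , eqB) → A∦B (lookup⇒[]= v A eqA) (lookup⇒[]= v B eqB)))

    -- Disjointness is asked of the `Y i` because the sum of their weights must not exceed the
    -- weight of their union; for the `X i` subadditivity suffices.
    weight-unionᵗ-mono : ∀ {q} (X Y : Fin q → Timed (Subset size)) →
      (∀ {i j v} → v ∈ value (Y i) → v ∈ value (Y j) → i ≡ j) →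
      (∀ i → weight (value (X i)) ≼ weight (value (Y i))) →
      weight (value (foldrᵗ _∪ᵗ_ ∅ᵗ X)) ≼ weight (value (foldrᵗ _∪ᵗ_ ∅ᵗ Y))
    weight-unionᵗ-mono {zero}  X Y disjoint X≼Y = ≼-refl
    weight-unionᵗ-mono {suc q} X Y disjoint X≼Y = begin
      weight (value (X₀ ∪ᵗ X₊))  ≤⟨ weight-subadditive _ X₀ X₊ (∈-∪ᵗ⁻ X₀ X₊) ⟩
      weight X₀ ⊕ weight X₊      ≤⟨ ⊕-mono-≼ (X≼Y zero) (weight-unionᵗ-mono (X ∘ suc) (Y ∘ suc)
                                      (λ v∈Yᵢ v∈Yⱼ → suc-injective (disjoint v∈Yᵢ v∈Yⱼ)) (X≼Y ∘ suc)) ⟩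
      weight Y₀ ⊕ weight Y₊      ≤⟨ weight-superadditive _ Y₀ Y₊ (∈-∪ᵗ⁺ Y₀ Y₊) Y₀∦Y₊ ⟩
      weight (value (Y₀ ∪ᵗ Y₊))  ∎
      where
      X₀ = value (X zero)
      Y₀ = value (Y zero)
      X₊ = value (foldrᵗ _∪ᵗ_ ∅ᵗ (X ∘ suc))
      Y₊ = value (foldrᵗ _∪ᵗ_ ∅ᵗ (Y ∘ suc))
      Y₀∦Y₊ : ∀ {v} → v ∈ Y₀ → ¬ v ∈ Y₊
      Y₀∦Y₊ v∈Y₀ v∈Y₊ with _ , v∈Yⱼ ← ∈-unionᵗ⁻ (Y ∘ suc) v∈Y₊ = contradiction (disjoint v∈Y₀ v∈Yⱼ) λ ()

    -- Disjointness over whole index vectors splits along the recursion: heads separate the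
    -- branches, tails separate the sets within a branch.
    weight-⋃ᵗ-mono : ∀ {q} e (X Y : Vec (Fin q) e → Timed (Subset size)) →
      (∀ {i j v} → v ∈ value (Y i) → v ∈ value (Y j) → i ≡ j) →
      (∀ i → weight (value (X i)) ≼ weight (value (Y i))) →
      weight (value (⋃ᵗ q e X)) ≼ weight (value (⋃ᵗ q e Y))
    weight-⋃ᵗ-mono zero    X Y disjoint X≼Y = X≼Y []
    weight-⋃ᵗ-mono (suc e) X Y disjoint X≼Y = weight-unionᵗ-mono _ _
      (λ v∈Yₓ v∈Yᵧ → ∷-injectiveˡ (disjoint (proj₂ (∈-⋃ᵗ⁻ e _ v∈Yₓ)) (proj₂ (∈-⋃ᵗ⁻ e _ v∈Yᵧ))))
      (λ x → weight-⋃ᵗ-mono e (λ xs → X (x ∷ xs)) (λ xs → Y (x ∷ xs))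
        (λ v∈Yᵢ v∈Yⱼ → ∷-injectiveʳ (disjoint v∈Yᵢ v∈Yⱼ)) (λ xs → X≼Y (x ∷ xs)))

    weight-whenᵗ-mono : ∀ {p} {P : Set p} (P? : Dec P) (X Y : Timed (Subset size)) →
      weight (value X) ≼ weight (value Y) → weight (value (whenᵗ P? X)) ≼ weight (value (whenᵗ P? Y))
    weight-whenᵗ-mono (yes _) X Y X≼Y = X≼Y
    weight-whenᵗ-mono (no _)  X Y X≼Y = ≼-refl

    value-weightᵗ : ∀ S → value (weightᵗ S) ≡ weight S
    value-weightᵗ S = sum-value (lookup S) w
      where
      sum-value : ∀ {n} (s : Fin n → Bool) (w : Fin n → Carrier) →
        value (foldrᵗ (λ x y → step (x ⊕ y)) (step 0#) λ v → step (s v) >>= λ b → if b then step (w v) else step 0#)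
          ≡ ∑ (λ v → [ s v ] w v)
      sum-value {zero}  s w = refl
      sum-value {suc n} s w = cong₂ _⊕_ (if-float value (s zero)) (sum-value (s ∘ suc) (w ∘ suc))

    time-weightᵗ-≤ : ∀ {M} S → size ≤ M → time (weightᵗ S) ≤ M * 4 + 1
    time-weightᵗ-≤ S size≤M = time-foldrᵗ-≤ _ size≤M (λ _ _ → ≤-refl) ≤-refl
      (λ v → s≤s (time-if-≤ (lookup S v) ≤-refl ≤-refl))

-- Strips

module _ {c ℓ₁ ℓ₂} (W : OrderedAbelianGroup c ℓ₁ ℓ₂) (d ω : ℕ) (2<ω : 2 < ω) where

  private
    κ = k W d ω 2<ω
    e = d ∸ 1

    instance
      κ-nonZero : NonZero κ
      κ-nonZero = >-nonZero (m<n⇒0<n∸m (<-trans (n<1+n 1) 2<ω))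

    ax : Fin e → Fin d
    ax = axis W d ω 2<ω

    Index : ℕ → Set
    Index = StripIndex W d ω 2<ω

    parityOf : ∀ {n} → Index n → Parity
    parityOf {n} i = value (parityᵗ W d ω 2<ω {n = n} i)

  -- In zero-based coordinates the strip condition is division with remainder by `κ`, the strip
  -- index being the quotient.
  inStrip-coordinate : (i : Index n) (p : Point d n) → InStrip W d ω 2<ω i p → ∀ h →
                       ∃[ j ] j < κ × toℕ (lookup p (ax h)) ≡ κ * toℕ (lookup i h) + j
  inStrip-coordinate i p p∈i h with j , eq ← p∈i h =
    toℕ j , toℕ<n j , sucℕ-injective (trans eq (+-suc _ (toℕ j)))

  stripIndex-≤ : ∀ (i j : Index n) (p q : Point d n) r → InStrip W d ω 2<ω i p → InStrip W d ω 2<ω j q → ∀ h →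
                 toℕ (lookup q (ax h)) ≤ toℕ (lookup p (ax h)) + κ * r →
                 toℕ (lookup j h) ≤ toℕ (lookup i h) + r
  stripIndex-≤ i j p q r p∈i q∈j h le
    with s , s<κ , p≡ ← inStrip-coordinate i p p∈i h
       | _ , _   , q≡ ← inStrip-coordinate j q q∈j h
    rewrite p≡ | q≡ = block-≤ κ s<κ le

  same-coordinate⇒same-index : ∀ (i j : Index n) (p q : Point d n) →
    InStrip W d ω 2<ω i p → InStrip W d ω 2<ω j q → ∀ h →
    lookup p (ax h) ≡ lookup q (ax h) → lookup i h ≡ lookup j h
  same-coordinate⇒same-index i j p q p∈i q∈j h eq = toℕ-injective (≤-antisym
    (≤-trans (stripIndex-≤ j i q p 0 q∈j p∈i h (le eq)) (≤-reflexive (+-identityʳ _)))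
    (≤-trans (stripIndex-≤ i j p q 0 p∈i q∈j h (le (sym eq))) (≤-reflexive (+-identityʳ _))))
    where
    le : ∀ {x y : Fin _} → x ≡ y → toℕ x ≤ toℕ y + κ * 0
    le refl = m≤m+n _ _

  strip-unique : ∀ (i j : Index n) (p : Point d n) → InStrip W d ω 2<ω i p → InStrip W d ω 2<ω j p → i ≡ j
  strip-unique i j p p∈i p∈j = lookup-extensional i j λ h →
    same-coordinate⇒same-index i j p p p∈i p∈j h refl

  -- Separation of strips in contrapositive form: mutual visibility within range makes the indices
  -- differ by at most 1 in one component and agree in the others, and parity turns this into
  -- equality.
  visible∧same-parity⇒same-strip : ∀ (i j : Index n) (p q : Point d n) →
    InStrip W d ω 2<ω i p → InStrip W d ω 2<ω j q →
    ShareLineOfSight p q → manhattan p q < ω → parityOf {n} i ≡ parityOf {n} j → i ≡ j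
  visible∧same-parity⇒same-strip {n} i j p q p∈i q∈j (h₀ , _ , unique) dist<ω same =
    lookup-extensional i j indices-agree
    where
    off-line : ∀ h → ax h ≢ h₀ → lookup i h ≡ lookup j h
    off-line h h≢h₀ with lookup p (ax h) ≟ᶠ lookup q (ax h)
    ... | yes eq  = same-coordinate⇒same-index i j p q p∈i q∈j h eq
    ... | no  neq = contradiction (sym (unique neq)) h≢h₀

    -- A distance below `ω` is at most `ω ∸ 1`, which is `κ`; the factor `1` is the `r` of
    -- `stripIndex-≤`.
    dist≤κ : ∀ h → ∣ toℕ (lookup p h) - toℕ (lookup q h) ∣ ≤ κ * 1
    dist≤κ h = ≤-trans (coordinate-distance-≤-manhattan p q h)
      (≤-trans (∸-monoˡ-≤ 1 dist<ω) (≤-reflexive (sym (*-identityʳ κ))))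

    near : ∀ h → toℕ (lookup i h) ≤ suc (toℕ (lookup j h)) × toℕ (lookup j h) ≤ suc (toℕ (lookup i h))
    near h =
      ≤-trans (stripIndex-≤ j i q p 1 q∈j p∈i h
        (≤-trans (m≤n+∣m-n∣ x y) (+-monoʳ-≤ y (dist≤κ (ax h))))) (≤-reflexive (+-comm _ 1)) ,
      ≤-trans (stripIndex-≤ i j p q 1 p∈i q∈j h
        (≤-trans (m≤n+∣n-m∣ y x) (+-monoʳ-≤ x (dist≤κ (ax h))))) (≤-reflexive (+-comm _ 1))
      where
      x = toℕ (lookup p (ax h))
      y = toℕ (lookup q (ax h))

    indices-agree : lookup i ≗ lookup j
    indices-agree h with ax h ≟ᶠ h₀
    -- If `h₀` is the last axis, along which strips are not cut, every `h` falls under this case.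
    ... | no  h≢h₀ = off-line h h≢h₀
    ... | yes refl = toℕ-injective (close∧same-parity⇒≡ (proj₁ (near h)) (proj₂ (near h))
      -- The parity of a strip is that of the sum of one-based components, hence the shift removed
      -- here. Distinct `h` have distinct axes, so `off-line` applies to all other components.
      (parity-suc-injective {toℕ (lookup i h)} {toℕ (lookup j h)} (sumᵗ-same-parity h
        (λ h′ h′≢h → cong ⟦_⟧ (off-line h′ (h′≢h ∘ inject≤-injective _ _ h′ h))) same)))

  -- The strip containing a given point

  stripOf : Point d n → Index n
  stripOf p = tabulate λ h → fromℕ< (/-<-ceiling κ (toℕ<n (lookup p (ax h))))

  -- Division with remainder: the quotient gives the strip index and the remainder the offset in the
  -- block.
  inStrip-stripOf : (p : Point d n) → InStrip W d ω 2<ω (stripOf p) p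
  inStrip-stripOf p h = fromℕ< (m%n<n x κ) , (begin
    suc x                                                       ≡⟨ cong suc (m≡m%n+[m/n]*n x κ) ⟩
    suc (x % κ + x / κ * κ)                                     ≡⟨ cong suc (+-comm (x % κ) _) ⟩
    suc (x / κ * κ + x % κ)                                     ≡⟨ +-suc _ _ ⟨
    x / κ * κ + suc (x % κ)                                     ≡⟨ cong (_+ suc (x % κ)) (*-comm (x / κ) κ) ⟩
    κ * (x / κ) + suc (x % κ)                                   ≡⟨ cong₂ (λ a b → κ * a + suc b) index≡ (sym (toℕ-fromℕ< _)) ⟩
    κ * toℕ (lookup (stripOf p) h) + ⟦ fromℕ< (m%n<n x κ) ⟧     ∎)
    where
    open ≡-Reasoning
    x = toℕ (lookup p (ax h))
    index≡ : x / κ ≡ toℕ (lookup (stripOf p) h)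
    index≡ = sym (trans (cong toℕ (lookup∘tabulate _ h)) (toℕ-fromℕ< _))

  -- Correctness and cost of the membership and parity tests

  inBlockᵗ : Index n → Point d n → Fin e → Fin κ → Timed Bool
  inBlockᵗ i p h j = do
    x  ← step (lookup p (ax h))
    iₕ ← step (lookup i h)
    r  ← step (⟦ iₕ ⟧ ∸ 1)
    s  ← step (κ * r)
    t  ← step (s + ⟦ j ⟧)
    step (⟦ x ⟧ ≡ᵇ t)

  value-inStripᵗ : (i : Index n) (p : Point d n) →
                   value (inStripᵗ W d ω 2<ω i p) ≡ does (inStrip? W d ω 2<ω i p)
  value-inStripᵗ i p =
    value-allᵗ (λ h → any? (inBlock? h)) (λ h → anyᵗ (inBlockᵗ i p h)) λ h →
      -- `refl` suffices because the Boolean of `_≟ℕ_` computes to `_≡ᵇ_` on the same two numbers.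
      value-anyᵗ (inBlock? h) (inBlockᵗ i p h) λ j → refl
    where
    inBlock? : ∀ h (j : Fin κ) → Dec (⟦ lookup p (ax h) ⟧ ≡ κ * (⟦ lookup i h ⟧ ∸ 1) + ⟦ j ⟧)
    inBlock? h j = ⟦ lookup p (ax h) ⟧ ≟ℕ κ * (⟦ lookup i h ⟧ ∸ 1) + ⟦ j ⟧

  -- Six steps of `inBlockᵗ` and one disjunction make 7; each axis adds one conjunction and each
  -- fold one initial step. The total is independent of `n`.
  inStrip-time : ℕ
  inStrip-time = e * (κ * 7 + 1 + 1) + 1

  time-inStripᵗ-≤ : (i : Index n) (p : Point d n) → time (inStripᵗ W d ω 2<ω i p) ≤ inStrip-time
  time-inStripᵗ-≤ i p =
    time-foldrᵗ-≤ (λ h → anyᵗ (inBlockᵗ i p h)) ≤-refl (λ _ _ → ≤-refl) ≤-refl λ h →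
      time-foldrᵗ-≤ (inBlockᵗ i p h) ≤-refl (λ _ _ → ≤-refl) ≤-refl (λ _ → ≤-refl)

  time-parityᵗ-≤ : (i : Index n) → time (parityᵗ W d ω 2<ω {n = n} i) ≤ e * 2 + 1 + 1
  time-parityᵗ-≤ i = +-monoˡ-≤ 1 (time-foldrᵗ-≤ {n = e} _ ≤-refl (λ _ _ → ≤-refl) ≤-refl (λ _ → ≤-refl))

  ⌈/k⌉-≤ : ∀ n → ⌈_/k⌉ W d ω 2<ω n ≤ n + (κ ∸ 1)
  ⌈/k⌉-≤ n = m/n≤m (n + (κ ∸ 1)) κ

  module _ (solver : StripSolver W d ω 2<ω) where

    open StripSolver solver using (solve; exact) renaming (polynomialTime to solve-polynomialTime)

    -- Independence and approximation ratio

    module _ (N : LoSNetwork W d ω n) where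

      open LoSNetwork N
      open OrderedAbelianGroup W using (_≼_; _⊕_; _≼?_; _·_; abelianGroup; isDecTotalOrder)
      open AbelianGroup abelianGroup using (identityʳ) renaming (sym to ≈-sym)
      open IsDecTotalOrder isDecTotalOrder using () renaming (total to ≼-total)
      open Poset (weightPoset W) using () renaming (refl to ≼-refl; reflexive to ≼-reflexive; trans to ≼-trans)

      private
        vertices : Index n → Subset size
        vertices = stripVertices W d ω 2<ω N

        solved : Parity → Subset size
        solved π = value (solveStripsᵗ W d ω 2<ω solver π N)

      size≤n^d : size ≤ n ^ d
      size≤n^d = injection-into-grid⇒≤ f-injective

      -- The guarantees of the solver concern `strip`, while the algorithm calls it on the network
      -- induced by the tested vertices; this equality carries the guarantees over.
      testedVertices≡ : ∀ i → value (tabulateᵗ λ v → inStripᵗ W d ω 2<ω i (f v)) ≡ vertices i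
      testedVertices≡ i = trans (value-tabulateᵗ _) (tabulate-cong λ v → value-inStripᵗ i (f v))

      ∈-vertices⁻ : ∀ i v → v ∈ vertices i → InStrip W d ω 2<ω i (f v)
      ∈-vertices⁻ i v v∈ = true⇒ (inStrip? W d ω 2<ω i (f v))
        (trans (sym (lookup∘tabulate _ v)) ([]=⇒lookup v∈))
        where
        true⇒ : ∀ {P : Set} (P? : Dec P) → does P? ≡ true → P
        true⇒ (yes p) _ = p

      ∈-vertices⁺ : ∀ {i v} → InStrip W d ω 2<ω i (f v) → v ∈ vertices i
      ∈-vertices⁺ {i} {v} p∈i =
        lookup⇒[]= v _ (trans (lookup∘tabulate _ v) (dec-true (inStrip? W d ω 2<ω i (f v)) p∈i))

      optimumᵗ : Index n → Timed (Subset size)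
      optimumᵗ i = imageᵗ (vertices i) (value (solve (strip W d ω 2<ω N i)))

      value-solveStripᵗ : ∀ i → value (solveStripᵗ W d ω 2<ω solver N i) ≡ value (optimumᵗ i)
      -- The type of the solution depends on `S`, so `S` is replaced at once in the network, in its
      -- solution and in the enumeration.
      value-solveStripᵗ i = cong (λ S → value (imageᵗ S (value (solve (induced W N S))))) (testedVertices≡ i)

      solveIfᵗ : Parity → Index n → Timed (Subset size)
      solveIfᵗ π i = do
        πᵢ ← parityᵗ W d ω 2<ω {n = n} i
        b  ← step (does (πᵢ ≟ℙ π))
        if b then solveStripᵗ W d ω 2<ω solver N i else ∅ᵗ

      ∈-solveIfᵗ⁻ : ∀ {π i v} → v ∈ value (solveIfᵗ π i) →
        parityOf {n} i ≡ π × ∃[ u ] u ∈ value (solve (strip W d ω 2<ω N i)) × element (vertices i) u ≡ v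
      ∈-solveIfᵗ⁻ {π} {i} v∈
        with πᵢ≡π , v∈i ← ∈-whenᵗ⁻ (parityOf {n} i ≟ℙ π) (solveStripᵗ W d ω 2<ω solver N i) v∈ =
        πᵢ≡π , ∈-imageᵗ⁻ (vertices i) _ (subst (_ ∈_) (value-solveStripᵗ i) v∈i)

      solved-independent : ∀ π → IsIndependent (solved π)
      solved-independent π u∈ v∈ adj
        with i , u∈i ← ∈-⋃ᵗ⁻ e (solveIfᵗ π) u∈ | j , v∈j ← ∈-⋃ᵗ⁻ e (solveIfᵗ π) v∈
        with πᵢ≡π , x , x∈ , refl ← ∈-solveIfᵗ⁻ {π} {i} u∈i
           | πⱼ≡π , y , y∈ , refl ← ∈-solveIfᵗ⁻ {π} {j} v∈j
        with share , near ← Equivalence.to (adjacency _ _) adj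
        with refl ← visible∧same-parity⇒same-strip i j (f (element (vertices i) x)) (f (element (vertices j) y))
                      (∈-vertices⁻ i _ (element-∈ (vertices i) x)) (∈-vertices⁻ j _ (element-∈ (vertices j) y))
                      share near (trans πᵢ≡π (sym πⱼ≡π)) =
        -- With both endpoints in one strip, `adj` is by definition an edge of that induced network.
        proj₁ (exact N i) x∈ y∈ adj

      restrictedᵗ : Subset size → Index n → Timed (Subset size)
      restrictedᵗ O i = imageᵗ (vertices i) (restrict (vertices i) O)

      restrictIfᵗ : Subset size → Parity → Index n → Timed (Subset size)
      restrictIfᵗ O π i = whenᵗ (parityOf {n} i ≟ℙ π) (restrictedᵗ O i)

      -- The trace of `O` is independent in the strip, so exactness bounds its weight there;
      -- `∑-imageᵗ` transports both weights to the whole graph.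
      strip-optimal : ∀ O → IsIndependent O → ∀ i →
                      weight (value (restrictedᵗ O i)) ≼ weight (value (solveStripᵗ W d ω 2<ω solver N i))
      strip-optimal O O-independent i = begin
        weight (value (restrictedᵗ O i))                   ≈⟨ ∑-imageᵗ W w S (restrict S O) ⟩
        Strip.weight (restrict S O)                        ≤⟨ proj₂ (exact N i) (restrict S O) (λ u∈ v∈ →
                                                                O-independent (∈-restrict⁻ S O u∈) (∈-restrict⁻ S O v∈)) ⟩
        Strip.weight T                                     ≈⟨ ∑-imageᵗ W w S T ⟨
        weight (value (optimumᵗ i))                        ≡⟨ cong weight (value-solveStripᵗ i) ⟨
        weight (value (solveStripᵗ W d ω 2<ω solver N i))  ∎
        where
        open PartialOrderReasoning (weightPoset W)
        S = vertices i
        module Strip = LoSNetwork (strip W d ω 2<ω N i)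
        T = value (solve (strip W d ω 2<ω N i))

      weight-restricted-≼-solved : ∀ O → IsIndependent O → ∀ π →
                                   weight (value (⋃ᵗ _ e (restrictIfᵗ O π))) ≼ weight (solved π)
      weight-restricted-≼-solved O O-independent π =
        weight-⋃ᵗ-mono W graph e (restrictIfᵗ O π) (solveIfᵗ π) disjoint λ i →
          weight-whenᵗ-mono W graph (parityOf {n} i ≟ℙ π) (restrictedᵗ O i) (solveStripᵗ W d ω 2<ω solver N i)
            (strip-optimal O O-independent i)
        where
        -- A vertex in the solutions of two strips lies in both strips, and `strip-unique`
        -- identifies their indices.
        disjoint : ∀ {i j v} → v ∈ value (solveIfᵗ π i) → v ∈ value (solveIfᵗ π j) → i ≡ j
        disjoint {i} {j} v∈i v∈j
          with _ , x , _ , refl ← ∈-solveIfᵗ⁻ {π} {i} v∈i | _ , y , _ , eq ← ∈-solveIfᵗ⁻ {π} {j} v∈j =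
          strip-unique i j (f (element (vertices i) x)) (∈-vertices⁻ i _ (element-∈ (vertices i) x))
            (∈-vertices⁻ j _ (subst (_∈ vertices j) eq (element-∈ (vertices j) y)))

      odd-or-even : ∀ O {v} → v ∈ O →
        v ∈ value (⋃ᵗ _ e (restrictIfᵗ O 1ℙ)) ⊎ v ∈ value (⋃ᵗ _ e (restrictIfᵗ O 0ℙ))
      odd-or-even O {v} v∈O = by-parity _ refl
        where
        i = stripOf (f v)

        in-part : ∀ π → parityOf {n} i ≡ π → v ∈ value (⋃ᵗ _ e (restrictIfᵗ O π))
        in-part π eq = ∈-⋃ᵗ⁺ e (restrictIfᵗ O π) i (∈-whenᵗ⁺ (parityOf {n} i ≟ℙ π) (restrictedᵗ O i) eq
          (∈-imageᵗ-restrict⁺ (vertices i) O (∈-vertices⁺ {i} (inStrip-stripOf (f v))) v∈O))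

        by-parity : ∀ π → parityOf {n} i ≡ π →
          v ∈ value (⋃ᵗ _ e (restrictIfᵗ O 1ℙ)) ⊎ v ∈ value (⋃ᵗ _ e (restrictIfᵗ O 0ℙ))
        by-parity 1ℙ eq = inj₁ (in-part 1ℙ eq)
        by-parity 0ℙ eq = inj₂ (in-part 0ℙ eq)

      weight-≼-odd⊕even : ∀ O → IsIndependent O → weight O ≼ (weight (solved 1ℙ) ⊕ weight (solved 0ℙ))
      weight-≼-odd⊕even O O-independent = begin
        weight O                                              ≤⟨ weight-subadditive W graph O (part 1ℙ) (part 0ℙ) (odd-or-even O) ⟩
        weight (part 1ℙ) ⊕ weight (part 0ℙ)                   ≤⟨ ⊕-mono-≼ W (weight-restricted-≼-solved O O-independent 1ℙ)
                                                                            (weight-restricted-≼-solved O O-independent 0ℙ) ⟩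
        weight (solved 1ℙ) ⊕ weight (solved 0ℙ)               ∎
        where
        open PartialOrderReasoning (weightPoset W)
        part : Parity → Subset size
        part π = value (⋃ᵗ _ e (restrictIfᵗ O π))

      stripIndependentSet-independent : IsIndependent (value (stripIndependentSet W d ω 2<ω solver N))
      stripIndependentSet-independent
        with does (value (weightᵗ (solved 0ℙ)) ≼? value (weightᵗ (solved 1ℙ)))
      ... | true  = solved-independent 1ℙ
      ... | false = solved-independent 0ℙ

      -- `2 · x` unfolds to `x ⊕ (x ⊕ 0#)`. The heavier union bounds both summands of
      -- `weight-≼-odd⊕even`, and `identityʳ` accounts for the trailing `0#`.
      stripIndependentSet-ratio : ∀ O → IsIndependent O →
        weight O ≼ (2 · weight (value (stripIndependentSet W d ω 2<ω solver N)))
      stripIndependentSet-ratio O O-independent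
        with value (weightᵗ (solved 0ℙ)) ≼? value (weightᵗ (solved 1ℙ))
      ... | yes even≼odd = ≼-trans (weight-≼-odd⊕even O O-independent) (⊕-mono-≼ W ≼-refl
              (≼-trans (subst₂ _≼_ (value-weightᵗ W graph (solved 0ℙ)) (value-weightᵗ W graph (solved 1ℙ)) even≼odd)
                (≼-reflexive (≈-sym (identityʳ _)))))
      ... | no  even⋠odd = ≼-trans (weight-≼-odd⊕even O O-independent) (⊕-mono-≼ W
              (subst₂ _≼_ (value-weightᵗ W graph (solved 1ℙ)) (value-weightᵗ W graph (solved 0ℙ)) odd≼even)
              (≼-reflexive (≈-sym (identityʳ _))))
              where
              odd≼even : value (weightᵗ (solved 1ℙ)) ≼ value (weightᵗ (solved 0ℙ))
              odd≼even with ≼-total (value (weightᵗ (solved 1ℙ))) (value (weightᵗ (solved 0ℙ)))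
              ... | inj₁ le = le
              ... | inj₂ ge = contradiction ge even⋠odd

    -- Polynomial running time

    solve-time : ℕ → ℕ
    solve-time n = eval (proj₁ solve-polynomialTime) n

    -- In order: testing all vertices, copying the induced network, solving it, mapping the solution
    -- back. Throughout, `n ^ d` stands in for the number of vertices.
    strip-time : ℕ → ℕ
    strip-time n = (n ^ d * (inStrip-time + 1) + 1) + (n ^ d * suc d + (solve-time n + (n ^ d + 1)))

    -- The inner `1` is the parity comparison; the costs of the two branches after it are added
    -- instead of maximised.
    strips-time : ℕ → ℕ
    strips-time n = ⋃-time (n + (κ ∸ 1)) e (n ^ d) (e * 2 + 1 + 1 + (1 + (strip-time n + (n ^ d * 2 + 1))))

    -- The final `2` pays for comparing the two weights and for returning the choice.
    total-time : ℕ → ℕ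
    total-time n = strips-time n + (strips-time n + ((n ^ d * 4 + 1) + ((n ^ d * 4 + 1) + 2)))

    time-solveStripᵗ-≤ : (N : LoSNetwork W d ω n) (i : Index n) →
                         time (solveStripᵗ W d ω 2<ω solver N i) ≤ strip-time n
    time-solveStripᵗ-≤ N i = +-mono-≤
      (time-tabulateᵗ-≤ _ (size≤n^d N) (λ v → time-inStripᵗ-≤ i (LoSNetwork.f N v)))
      (+-mono-≤ (*-monoˡ-≤ (suc d) (size≤n^d N))
        (+-mono-≤
          (≤-trans (≤-reflexive (cong (λ S → time (solve (induced W N S))) (testedVertices≡ N i)))
            (proj₂ solve-polynomialTime N i))
          (≤-trans (≤-reflexive (time-imageᵗ (value (tabulateᵗ λ v → inStripᵗ W d ω 2<ω i (LoSNetwork.f N v))) _))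
            (+-monoˡ-≤ 1 (size≤n^d N)))))

    time-solveStripsᵗ-≤ : ∀ π (N : LoSNetwork W d ω n) →
                          time (solveStripsᵗ W d ω 2<ω solver π N) ≤ strips-time n
    time-solveStripsᵗ-≤ {n} π N = time-⋃ᵗ-≤ e (solveIfᵗ N π) (⌈/k⌉-≤ n) (size≤n^d N) λ i →
      +-mono-≤ (time-parityᵗ-≤ {n} i) (s≤s (time-if-≤ (does (parityOf {n} i ≟ℙ π))
        (time-solveStripᵗ-≤ N i) (time-∅ᵗ-≤ (size≤n^d N))))

    time-stripIndependentSet-≤ : (N : LoSNetwork W d ω n) →
                                 time (stripIndependentSet W d ω 2<ω solver N) ≤ total-time n
    time-stripIndependentSet-≤ N =
      +-mono-≤ (time-solveStripsᵗ-≤ 1ℙ N) (+-mono-≤ (time-solveStripsᵗ-≤ 0ℙ N)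
        (+-mono-≤ (time-weightᵗ-≤ W graph (value (solveStripsᵗ W d ω 2<ω solver 1ℙ N)) (size≤n^d N))
          (+-mono-≤ (time-weightᵗ-≤ W graph (value (solveStripsᵗ W d ω 2<ω solver 0ℙ N)) (size≤n^d N)) ≤-refl)))
      where open LoSNetwork N using (graph)

    poly-total-time : PolynomiallyBounded total-time
    poly-total-time = poly-+ poly-strips-time (poly-+ poly-strips-time
      (poly-+ poly-weight-time (poly-+ poly-weight-time (poly-const 2))))
      where
      poly-n^d-linear : ∀ a b → PolynomiallyBounded (λ n → n ^ d * a + b)
      poly-n^d-linear a b = poly-+ (poly-* (poly-^ d) (poly-const a)) (poly-const b)

      poly-weight-time : PolynomiallyBounded (λ n → n ^ d * 4 + 1)
      poly-weight-time = poly-n^d-linear 4 1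

      poly-strip-time : PolynomiallyBounded strip-time
      poly-strip-time = poly-+ (poly-n^d-linear (inStrip-time + 1) 1)
        (poly-+ (poly-* (poly-^ d) (poly-const (suc d)))
          (poly-+ (proj₁ solve-polynomialTime , λ _ → ≤-refl) (poly-+ (poly-^ d) (poly-const 1))))

      poly-strips-time : PolynomiallyBounded strips-time
      poly-strips-time = poly-⋃-time e (poly-+ poly-id (poly-const (κ ∸ 1))) (poly-^ d)
        (poly-+ (poly-const (e * 2 + 1 + 1))
          (poly-+ (poly-const 1) (poly-+ poly-strip-time (poly-n^d-linear 2 1))))

theorem6 : ∀ {c ℓ₁ ℓ₂} (W : OrderedAbelianGroup c ℓ₁ ℓ₂) (d ω : ℕ) (2≤d : 2 ≤ d) (2<ω : 2 < ω)
    (solver : StripSolver W d ω 2<ω) →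
    IsMISApproximationAlgorithm W 2 d ω (stripIndependentSet W d ω 2<ω solver)
theorem6 W d ω _ 2<ω solver = record
  { polynomialTime = proj₁ bound , λ {n} N →
      ≤-trans (time-stripIndependentSet-≤ W d ω 2<ω solver N) (proj₂ bound n)
  ; independent    = stripIndependentSet-independent W d ω 2<ω solver
  ; ratio          = λ N O (O-independent , _) →
      stripIndependentSet-ratio W d ω 2<ω solver N O O-independent
  }
  where bound = poly-total-time W d ω 2<ω solver
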